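{- For all integers $1\le t\le r$ there exists an integer $n_0=n_0(r,t)$ such that the following holds for all integers $k\ge 2$ and $r\le n_1\le n_2\le\cdots\le n_k$ with $n_2\ge n_0$. Let $\mathscr{F}\subseteq\mathcal{K}_r(n_1,\ldots,n_k)$ be a $t$-intersecting family. Then \[ |\mathscr{F}|\le\frac{(n_1-t)_{r-t}\cdots(n_k-t)_{r-t}}{(r-t)!}. \] Furthermore, equality is attained if and only if $\mathscr{F}$ is a $t$-star of $\mathcal{K}_r(n_1,\ldots,n_k)$.
   Context: For a positive integer $n$, $[n]=\{1,\ldots,n\}$. For non-negative integers $b\le a$, $(a)_b=\frac{a!}{(a-b)!}$. $\mathcal{K}(n_1,\ldots,n_k)$ denotes the complete $k$-partite $k$-graph with parts $[n_1],\ldots,[n_k]$ (regarded as disjoint); its edges are identified with the $k$-tuples $(x_1,\ldots,x_k)\in[n_1]\times\cdots\times[n_k]$. An $r$-matching is a set of $r$ pairwise vertex-disjoint edges, i.e. a set of $r$ such $k$-tuples any two of which differ in every coordinate. $\mathcal{K}_r(n_1,\ldots,n_k)$ is the set of all $r$-matchings of $\mathcal{K}(n_1,\ldots,n_k)$. A family $\mathscr{F}\subseteq\mathcal{K}_r(n_1,\ldots,n_k)$ is $t$-intersecting if any two members of $\mathscr{F}$ share at least $t$ edges. A $t$-star of $\mathcal{K}_r(n_1,\ldots,n_k)$ is a family of the form $\{M\in\mathcal{K}_r(n_1,\ldots,n_k): C\subseteq M\}$ for some $t$-matching $C\in\mathcal{K}_t(n_1,\ldots,n_k)$. -}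

module Defs where

open import Data.Fin.Base using (Fin; zero; suc)
import Data.Fin.Properties as Fin
open import Data.List.Base using (List; length; filter; product)
open import Data.List.Membership.DecPropositional using (_∈?_)
import Data.List.Membership.Setoid as SetoidMembership
open import Data.List.Relation.Binary.BagAndSetEquality using ([_]-Equality; set)
open import Data.List.Relation.Binary.Subset.Propositional using (_⊆_)
open import Data.List.Relation.Unary.AllPairs using (AllPairs)
open import Data.List.Relation.Unary.Unique.Setoid using (Unique)
open import Data.Nat.Base using (ℕ; _∸_; _/_; _!; _≤_)
open import Data.Nat.Combinatorics using (_P_)
open import Data.Nat.Properties using (_!≢0)
open import Data.Product.Base using (∃-syntax; _×_; _,_; uncurry)
open import Data.Vec.Base using (Vec; lookup; map; toList)
open import Data.Vec.Relation.Unary.All using (All; []; _∷_)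
open import Function.Bundles using (_⇔_)
open import Level using (0ℓ)
open import Relation.Binary.Bundles using (Setoid)
import Relation.Binary.Construct.On as On
open import Relation.Binary.Definitions using (DecidableEquality)
open import Relation.Binary.PropositionalEquality using (_≡_; _≢_; refl; cong₂)
open import Relation.Nullary.Decidable using (yes; map′; _×-dec_)

-- The parts are Fin n₁, …, Fin nₖ, i.e. vertices are numbered from 0; an edge
-- is a k-tuple.  All Fin n is used rather than (i : Fin k) → Fin (lookup n i)
-- so that equality of edges is propositional equality.
Edge : ∀ {k} → Vec ℕ k → Set
Edge n = All Fin n

coord : ∀ {k} {n : Vec ℕ k} → Edge n → (i : Fin k) → Fin (lookup n i)
coord (x ∷ e) zero    = x
coord (x ∷ e) (suc i) = coord e i

_≟ᴱ_ : ∀ {k} {n : Vec ℕ k} → DecidableEquality (Edge n)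
[]      ≟ᴱ []       = yes refl
(x ∷ e) ≟ᴱ (y ∷ e′) =
  map′ (uncurry (cong₂ _∷_)) (λ { refl → refl , refl }) ((x Fin.≟ y) ×-dec (e ≟ᴱ e′))

Disjoint : ∀ {k} {n : Vec ℕ k} → Edge n → Edge n → Set
Disjoint e e′ = ∀ i → coord e i ≢ coord e′ i

-- A set of r edges is listed in some order; disjointness forbids repetition
-- (when k ≥ 1), and the order is forgotten by 𝒦 below.
record Matching {k} (n : Vec ℕ k) (r : ℕ) : Set where
  field
    edges    : List (Edge n)
    size     : length edges ≡ r
    disjoint : AllPairs Disjoint edges

open Matching public

-- The set of r-matchings; two of them are equal when they have the same edges.
𝒦 : ∀ {k} → ℕ → Vec ℕ k → Setoid 0ℓ 0ℓ
𝒦 r n = On.setoid ([ set ]-Equality (Edge n)) (edges {n = n} {r = r})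

∣_∩_∣ : ∀ {k} {n : Vec ℕ k} {r} → Matching n r → Matching n r → ℕ
∣ M ∩ M′ ∣ = length (filter (λ e → _∈?_ _≟ᴱ_ e (edges M′)) (edges M))

-- A (finite) set of r-matchings, listed without repetition up to equality in 𝒦.
record Family {k} (n : Vec ℕ k) (r : ℕ) : Set where
  field
    members : List (Matching n r)
    unique  : Unique (𝒦 r n) members

open Family public

∣_∣ : ∀ {k} {n : Vec ℕ k} {r} → Family n r → ℕ
∣ F ∣ = length (members F)

infix 4 _∈ᶠ_

_∈ᶠ_ : ∀ {k} {n : Vec ℕ k} {r} → Matching n r → Family n r → Set
_∈ᶠ_ {n = n} {r} M F = SetoidMembership._∈_ (𝒦 r n) M (members F)

Intersecting : ∀ {k} {n : Vec ℕ k} {r} → ℕ → Family n r → Set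
Intersecting t F = ∀ M M′ → M ∈ᶠ F → M′ ∈ᶠ F → t ≤ ∣ M ∩ M′ ∣

IsStar : ∀ {k} {n : Vec ℕ k} {r} → ℕ → Family n r → Set
IsStar {n = n} t F =
  ∃[ C ] (∀ M → M ∈ᶠ F ⇔ edges {n = n} {r = t} C ⊆ edges M)

-- (n₁ - t)_{r-t} ⋯ (nₖ - t)_{r-t} / (r - t)!, where a P b is the falling
-- factorial (a)_b.  For k ≥ 1 and t ≤ r ≤ nᵢ the division is exact, since
-- (r - t)! already divides (n₁ - t)_{r-t}.
starSize : ∀ {k} → Vec ℕ k → (r t : ℕ) → ℕ
starSize n r t =
  _/_ (product (toList (map (λ nᵢ → (nᵢ ∸ t) P (r ∸ t)) n)))
      ((r ∸ t) !) {{(r ∸ t) !≢0}}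

{-# OPTIONS --safe #-}

-- Counting r-matchings through a fixed s-matching D: summing, over the edges e
-- disjoint from D, the number of r-matchings through D and e counts each
-- r-matching r - s times, so by induction there are ∏ᵢ (nᵢ - s)_{r-s} / (r - s)!.
--
-- Suppose F is t-intersecting and not contained in a t-star.  For each set D of
-- at most t edges some M′ ∈ F is such that every member of F containing D
-- shares with M′ an edge outside D: any M′ will do if |D| < t, and any M′ ⊉ D
-- if |D| = t.  Branching t + 1 times over the r edges of such an M′ places F in
-- r^(t+1) families of matchings through t + 1 fixed edges.  Each of these is
-- smaller than a t-star by a factor (∏ᵢ (nᵢ - t)) / (r - t) ≥ n₂ - t.
-- The summand (r - t - 1)! of n₀ keeps the inequality strict after the division.
module Submission where

open import Defs
open import Data.Bool.Base using (true; false)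
open import Data.Empty using (⊥-elim)
open import Data.Fin.Base using (Fin; zero; suc)
import Data.Fin.Properties as Fin
open import Data.List.Base
  using (List; []; _∷_; _++_; length; filter; map; allFin; cartesianProductWith)
open import Data.List.Properties
  using (length-++; length-++-sucʳ; length-map; length-filter; length-tabulate; filter-some)
open import Data.List.Membership.Propositional using (_∈_; _∉_; find; lose)
open import Data.List.Membership.Propositional.Properties
  using (∈-∃++; ∈-++⁺ˡ; ∈-++⁺ʳ; ∈-++⁻; ∈-filter⁺; ∈-filter⁻; ∈-allFin;
         ∈-map⁺; ∈-map⁻; ∈-cartesianProductWith⁺; ∈-cartesianProductWith⁻)
open import Data.List.Membership.DecPropositional using (_∈?_)
import Data.List.Membership.Setoid as SetoidMembership
import Data.List.Membership.Setoid.Properties as SetoidMembershipP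
open import Data.List.Relation.Binary.Subset.Propositional using (_⊆_)
open import Data.List.Relation.Binary.Subset.Propositional.Properties
  using (⊆-trans; filter-⊆; ∈-∷⁺ʳ)
open import Data.List.Relation.Binary.Subset.DecPropositional using (_⊆?_)
open import Data.List.Relation.Unary.All as All using (All; []; _∷_)
open import Data.List.Relation.Unary.All.Properties using (¬Any⇒All¬; All¬⇒¬Any)
open import Data.List.Relation.Unary.AllPairs using (AllPairs; []; _∷_)
import Data.List.Relation.Unary.AllPairs as AllPairs
import Data.List.Relation.Unary.AllPairs.Properties as AllPairs
open import Data.List.Relation.Unary.Any as Any using (Any; here; there; any?)
open import Data.List.Relation.Unary.Unique.Propositional using (Unique)
open import Data.List.Relation.Unary.Unique.Propositional.Properties
  using (filter⁺; allFin⁺; cartesianProductWith⁺)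
import Data.List.Relation.Unary.Unique.Setoid as SetoidUnique
import Data.List.Relation.Unary.Unique.Setoid.Properties as SetoidUniqueP
open import Data.Nat.Base
open import Data.Nat.Combinatorics using (_P_)
open import Data.Nat.Combinatorics.Specification using (nP′k≡n[n∸1P′k∸1])
open import Data.Nat.DivMod using (m*n/n≡m; /-monoˡ-≤)
open import Data.Nat.ListAction using (sum; product)
open import Data.Nat.Properties
open import Data.Nat.Tactic.RingSolver using (solve-∀)
open import Data.Product.Base using (∃-syntax; _×_; _,_; proj₁; proj₂)
open import Data.Sum.Base as Sum using (_⊎_; inj₁; inj₂)
open import Data.Vec.Base as Vec using (Vec; []; _∷_; lookup; toList)
import Data.Vec.Relation.Unary.All as VecAll
open import Data.Vec.Relation.Unary.Linked using (Linked; _∷_)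
open import Data.Vec.Relation.Unary.Linked.Properties using (Linked⇒All)
open import Function.Base using (_∘_; id; case_of_)
open import Function.Bundles using (_⇔_; mk⇔; Equivalence)
open import Relation.Binary.Bundles using (Setoid)
open import Relation.Binary.Definitions using (DecidableEquality)
open import Relation.Binary.PropositionalEquality
  using (_≡_; _≢_; refl; sym; trans; cong; cong₂; subst; module ≡-Reasoning)
open import Relation.Nullary.Decidable using (Dec; yes; no; does; decidable-stable; ¬?; map′; _×-dec_)
open import Relation.Nullary.Negation using (¬_; contradiction)
open import Relation.Unary using (Decidable)

-- Lists as finite sets

module _ {A : Set} where

  All-⊎ : ∀ {B : Set} {Q : A → Set} {xs} → All (λ x → B ⊎ Q x) xs → B ⊎ All Q xs
  All-⊎ []              = inj₂ []
  All-⊎ (inj₁ b  ∷ _)   = inj₁ b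
  All-⊎ (inj₂ px ∷ pxs) = Sum.map₂ (px ∷_) (All-⊎ pxs)

  length-filter-¬ : ∀ {Q : A → Set} (Q? : Decidable Q) xs →
    length (filter (¬? ∘ Q?) xs) + length (filter Q? xs) ≡ length xs
  length-filter-¬ Q? []       = refl
  length-filter-¬ Q? (x ∷ xs) with does (Q? x)
  ... | true  = trans (+-suc _ _) (cong suc (length-filter-¬ Q? xs))
  ... | false = cong suc (length-filter-¬ Q? xs)

  Unique-⊆⇒length-≤ : ∀ {xs ys : List A} → Unique xs → xs ⊆ ys → length xs ≤ length ys
  Unique-⊆⇒length-≤ []            xs⊆ys = z≤n
  Unique-⊆⇒length-≤ {x ∷ xs} (x≢xs ∷ xs!) xs⊆ys with ∈-∃++ (xs⊆ys (here refl))
  ... | as , bs , refl = ≤-trans (s≤s (Unique-⊆⇒length-≤ xs! xs⊆as++bs))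
                                 (≤-reflexive (sym (length-++-sucʳ as x bs)))
    where
    xs⊆as++bs : xs ⊆ as ++ bs
    xs⊆as++bs y∈xs with ∈-++⁻ as (xs⊆ys (there y∈xs))
    ... | inj₁ y∈as          = ∈-++⁺ˡ y∈as
    ... | inj₂ (here refl)   = contradiction y∈xs (All¬⇒¬Any x≢xs)
    ... | inj₂ (there y∈bs)  = ∈-++⁺ʳ as y∈bs

  Unique-∷ : ∀ {x : A} {xs} → x ∉ xs → Unique xs → Unique (x ∷ xs)
  Unique-∷ x∉xs xs! = ¬Any⇒All¬ _ x∉xs ∷ xs!

  -- Pigeonhole: an element of `ys` outside `xs`, put in front of `xs`, would give a repetition-free
  -- list inside `ys` that is too long. This is how inclusions between matchings become equalities.
  Unique-⊆-antisym : DecidableEquality A → ∀ {xs ys : List A} →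
    Unique xs → xs ⊆ ys → length ys ≤ length xs → ys ⊆ xs
  Unique-⊆-antisym _≟_ {xs} xs! xs⊆ys |ys|≤|xs| {y} y∈ys with _∈?_ _≟_ y xs
  ... | yes y∈xs = y∈xs
  ... | no  y∉xs = contradiction
    (≤-trans (Unique-⊆⇒length-≤ (Unique-∷ y∉xs xs!) (∈-∷⁺ʳ y∈ys xs⊆ys)) |ys|≤|xs|)
    (<-irrefl refl)

  length-filter-∉ : (_≟_ : DecidableEquality A) {xs ys : List A} →
    Unique xs → Unique ys → ys ⊆ xs →
    length (filter (λ x → ¬? (_∈?_ _≟_ x ys)) xs) + length ys ≡ length xs
  length-filter-∉ _≟_ {xs} {ys} xs! ys! ys⊆xs =
    trans (cong (length (filter (¬? ∘ ∈ys?) xs) +_) |ys|≡) (length-filter-¬ ∈ys? xs)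
    where
    ∈ys? : Decidable (_∈ ys)
    ∈ys? x = _∈?_ _≟_ x ys
    |ys|≡ : length ys ≡ length (filter ∈ys? xs)
    |ys|≡ = ≤-antisym
      (Unique-⊆⇒length-≤ ys! (λ y∈ys → ∈-filter⁺ ∈ys? (ys⊆xs y∈ys) y∈ys))
      (Unique-⊆⇒length-≤ (filter⁺ ∈ys? xs!) (proj₂ ∘ ∈-filter⁻ ∈ys? {xs = xs}))

  length-filter-∷ : ∀ {Q : A → Set} (Q? : Decidable Q) x xs →
    length (filter Q? (x ∷ xs)) ≡ length (filter Q? (x ∷ [])) + length (filter Q? xs)
  length-filter-∷ Q? x xs with does (Q? x)
  ... | true  = refl
  ... | false = refl

  -- Factorial denominators are carried as the factor `a` on the left, so that division occurs only
  -- in the comparison with `starSize`. In plain counts `a` is 1.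
  sum-map-≤ : ∀ (f : A → ℕ) a {c xs} → All (λ x → a * f x ≤ c) xs →
    a * sum (map f xs) ≤ length xs * c
  sum-map-≤ f a []                     = ≤-reflexive (*-zeroʳ a)
  sum-map-≤ f a {xs = x ∷ xs} (p ∷ ps) = ≤-trans
    (≤-reflexive (*-distribˡ-+ a (f x) (sum (map f xs))))
    (+-mono-≤ p (sum-map-≤ f a ps))

  sum-map-≥ : ∀ (f : A → ℕ) a {c xs} → All (λ x → c ≤ a * f x) xs →
    length xs * c ≤ a * sum (map f xs)
  sum-map-≥ f a []                     = z≤n
  sum-map-≥ f a {xs = x ∷ xs} (p ∷ ps) = ≤-trans
    (+-mono-≤ p (sum-map-≥ f a ps))
    (≤-reflexive (sym (*-distribˡ-+ a (f x) (sum (map f xs)))))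

  sum-map-≡ : ∀ (f : A → ℕ) a {c xs} → All (λ x → a * f x ≡ c) xs →
    a * sum (map f xs) ≡ length xs * c
  sum-map-≡ f a ps = ≤-antisym
    (sum-map-≤ f a (All.map ≤-reflexive ps))
    (sum-map-≥ f a (All.map (≤-reflexive ∘ sym) ps))

  sum-map-+ : ∀ (f g : A → ℕ) xs → sum (map (λ x → f x + g x) xs) ≡ sum (map f xs) + sum (map g xs)
  sum-map-+ f g []       = refl
  sum-map-+ f g (x ∷ xs) rewrite sum-map-+ f g xs = lemma (f x) (g x) (sum (map f xs)) (sum (map g xs))
    where
    lemma : ∀ a b c d → a + b + (c + d) ≡ a + c + (b + d)
    lemma = solve-∀

  sum-map-cong : ∀ {f g : A → ℕ} → (∀ x → f x ≡ g x) → ∀ xs → sum (map f xs) ≡ sum (map g xs)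
  sum-map-cong f≗g []       = refl
  sum-map-cong f≗g (x ∷ xs) = cong₂ _+_ (f≗g x) (sum-map-cong f≗g xs)

double-counting : ∀ {A B : Set} {R : A → B → Set} (R? : ∀ a b → Dec (R a b)) xs ys →
  sum (map (λ x → length (filter (R? x) ys)) xs) ≡
  sum (map (λ y → length (filter (λ x → R? x y) xs)) ys)
double-counting R? []       ys = zeros ys
  where
  zeros : ∀ {B : Set} (ys : List B) → 0 ≡ sum (map (λ _ → 0) ys)
  zeros []       = refl
  zeros (_ ∷ ys) = zeros ys
double-counting R? (x ∷ xs) ys = begin
  length (filter (R? x) ys) + sum (map (λ x → length (filter (R? x) ys)) xs)
    ≡⟨ cong₂ _+_ (singleton ys) (double-counting R? xs ys) ⟩
  sum (map (λ y → length (filter (λ x → R? x y) (x ∷ []))) ys) +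
  sum (map (λ y → length (filter (λ x → R? x y) xs)) ys)
    ≡⟨ sum-map-+ _ _ ys ⟨
  sum (map (λ y → length (filter (λ x → R? x y) (x ∷ [])) + length (filter (λ x → R? x y) xs)) ys)
    ≡⟨ sum-map-cong (λ y → length-filter-∷ (λ x → R? x y) x xs) ys ⟨
  sum (map (λ y → length (filter (λ x → R? x y) (x ∷ xs))) ys) ∎
  where
  open ≡-Reasoning
  singleton : ∀ ys → length (filter (R? x) ys) ≡
    sum (map (λ y → length (filter (λ x → R? x y) (x ∷ []))) ys)
  singleton []       = refl
  singleton (y ∷ ys) with does (R? x y)
  ... | true  = cong suc (singleton ys)
  ... | false = singleton ys

length-cartesianProductWith : ∀ {A B C : Set} (f : A → B → C) xs ys →
  length (cartesianProductWith f xs ys) ≡ length xs * length ys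
length-cartesianProductWith f []       ys = refl
length-cartesianProductWith f (x ∷ xs) ys = begin
  length (map (f x) ys ++ cartesianProductWith f xs ys)
    ≡⟨ length-++ (map (f x) ys) ⟩
  length (map (f x) ys) + length (cartesianProductWith f xs ys)
    ≡⟨ cong₂ _+_ (length-map (f x) ys) (length-cartesianProductWith f xs ys) ⟩
  length ys + length xs * length ys ∎
  where open ≡-Reasoning

-- Products of falling factorials

∏ : ∀ {k} → (ℕ → ℕ) → Vec ℕ k → ℕ
∏ f n = product (toList (Vec.map f n))

∏-cong : ∀ {f g : ℕ → ℕ} → (∀ x → f x ≡ g x) → ∀ {k} (n : Vec ℕ k) → ∏ f n ≡ ∏ g n
∏-cong f≗g []      = refl
∏-cong f≗g (x ∷ n) = cong₂ _*_ (f≗g x) (∏-cong f≗g n)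

∏-* : ∀ (f g : ℕ → ℕ) {k} (n : Vec ℕ k) → ∏ (λ x → f x * g x) n ≡ ∏ f n * ∏ g n
∏-* f g []      = refl
∏-* f g (x ∷ n) rewrite ∏-* f g n = lemma (f x) (g x) (∏ f n) (∏ g n)
  where
  lemma : ∀ a b c d → a * b * (c * d) ≡ a * c * (b * d)
  lemma = solve-∀

∏-1 : ∀ {k} (n : Vec ℕ k) → ∏ (λ _ → 1) n ≡ 1
∏-1 []      = refl
∏-1 (_ ∷ n) = trans (+-identityʳ _) (∏-1 n)

1≤∏ : ∀ (f : ℕ → ℕ) {k} {n : Vec ℕ k} → VecAll.All (λ x → 1 ≤ f x) n → 1 ≤ ∏ f n
1≤∏ f VecAll.[]       = ≤-refl
1≤∏ f (p VecAll.∷ ps) = *-mono-≤ p (1≤∏ f ps)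

P-suc : ∀ n m → n P suc m ≡ n * ((n ∸ 1) P m)
P-suc zero    m       = refl
P-suc (suc n) zero    = refl
-- The range tests hidden in the two falling factorials reduce to this same Boolean, so one case
-- split evaluates both. If it is false, both vanish.
P-suc (suc n) (suc m) with suc m ≤ᵇ n
... | true  = nP′k≡n[n∸1P′k∸1] (suc n) (suc (suc m))
... | false = sym (*-zeroʳ (suc n))

1≤P : ∀ {n m} → m ≤ n → 1 ≤ n P m
1≤P {m = zero}          m≤n       = ≤-refl
1≤P {suc n} {suc m} (s≤s m≤n) =
  subst (1 ≤_) (sym (P-suc (suc n) m)) (*-mono-≤ (s≤s (z≤n {n})) (1≤P m≤n))

-- The leading factors, taken together, count the edges disjoint from `s` chosen ones; what remains
-- is the same kind of product with one more edge chosen. This is the recursion behind `star-count`.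
∏-P-suc : ∀ s m {k} (n : Vec ℕ k) →
  ∏ (λ x → (x ∸ s) P suc m) n ≡ ∏ (_∸ s) n * ∏ (λ x → (x ∸ suc s) P m) n
∏-P-suc s m n = trans (∏-cong step n) (∏-* (_∸ s) (λ x → (x ∸ suc s) P m) n)
  where
  step : ∀ x → (x ∸ s) P suc m ≡ (x ∸ s) * ((x ∸ suc s) P m)
  step x = trans (P-suc (x ∸ s) m)
    (cong (λ y → (x ∸ s) * (y P m)) (trans (∸-+-assoc x s 1) (cong (x ∸_) (+-comm s 1))))

-- Edges disjoint from a matching

_∈ᴱ?_ : ∀ {k} {n : Vec ℕ k} (e : Edge n) (es : List (Edge n)) → Dec (e ∈ es)
_∈ᴱ?_ = _∈?_ _≟ᴱ_

unused : ∀ {k x} {n : Vec ℕ k} → List (Edge (x ∷ n)) → List (Fin x)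
unused {x = x} D = filter (λ v → ¬? (_∈?_ Fin._≟_ v (map VecAll.head D))) (allFin x)

-- Disjointness from the edges of `D` is a separate condition on each coordinate, so these edges
-- form a product of sets of free vertices, and their number is a product over the parts.
avoiding : ∀ {k} (n : Vec ℕ k) → List (Edge n) → List (Edge n)
avoiding []      D = VecAll.[] ∷ []
avoiding (x ∷ n) D = cartesianProductWith VecAll._∷_ (unused D) (avoiding n (map VecAll.tail D))

tail-disjoint : ∀ {k x} {n : Vec ℕ k} {e e′ : Edge (x ∷ n)} →
  Disjoint e e′ → Disjoint (VecAll.tail e) (VecAll.tail e′)
tail-disjoint {e = _ VecAll.∷ _} {_ VecAll.∷ _} e#e′ i = e#e′ (suc i)

-- At least one part is required: with no parts, `Disjoint` holds vacuously even between an edge and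
-- itself.
disjoint⇒≢ : ∀ {k} {n : Vec ℕ (suc k)} {e e′ : Edge n} → Disjoint e e′ → e ≢ e′
disjoint⇒≢ e#e′ refl = e#e′ zero refl

disjoint-sym : ∀ {k} {n : Vec ℕ k} {e e′ : Edge n} → Disjoint e e′ → Disjoint e′ e
disjoint-sym e#e′ i = e#e′ i ∘ sym

∈-avoiding⁻ : ∀ {k} (n : Vec ℕ k) D {e} → e ∈ avoiding n D → All (Disjoint e) D
∈-avoiding⁻ []      D _ = All.universal (λ _ ()) D
∈-avoiding⁻ (x ∷ n) D e∈
  with v , e , v∈ , e∈ , refl ← ∈-cartesianProductWith⁻ VecAll._∷_ (unused D) (avoiding n (map VecAll.tail D)) e∈
  = All.tabulate disjoint-from
  where
  disjoint-from : ∀ {d} → d ∈ D → Disjoint (v VecAll.∷ e) d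
  disjoint-from {_ VecAll.∷ _} d∈D zero    refl =
    proj₂ (∈-filter⁻ (λ v → ¬? (_∈?_ Fin._≟_ v (map VecAll.head D))) {xs = allFin x} v∈)
      (∈-map⁺ VecAll.head d∈D)
  disjoint-from {_ VecAll.∷ _} d∈D (suc i) =
    All.lookup (∈-avoiding⁻ n (map VecAll.tail D) e∈) (∈-map⁺ VecAll.tail d∈D) i

∈-avoiding⁺ : ∀ {k} (n : Vec ℕ k) D {e} → All (Disjoint e) D → e ∈ avoiding n D
∈-avoiding⁺ []      D {VecAll.[]}    _   = here refl
∈-avoiding⁺ (x ∷ n) D {v VecAll.∷ e} e#D = ∈-cartesianProductWith⁺ VecAll._∷_
  (∈-filter⁺ _ (∈-allFin v) v∉)
  (∈-avoiding⁺ n (map VecAll.tail D) (All.tabulate tail#))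
  where
  v∉ : v ∉ map VecAll.head D
  v∉ v∈ with _ VecAll.∷ _ , d∈D , refl ← ∈-map⁻ VecAll.head v∈ = All.lookup e#D d∈D zero refl
  tail# : ∀ {d} → d ∈ map VecAll.tail D → Disjoint e d
  tail# d∈ with _ VecAll.∷ _ , d∈D , refl ← ∈-map⁻ VecAll.tail d∈ = All.lookup e#D d∈D ∘ suc

avoiding-unique : ∀ {k} (n : Vec ℕ k) D → Unique (avoiding n D)
avoiding-unique []      D = [] ∷ []
avoiding-unique (x ∷ n) D = cartesianProductWith⁺ VecAll._∷_ (λ { refl → refl , refl })
  (filter⁺ _ (allFin⁺ x)) (avoiding-unique n (map VecAll.tail D))

-- Since the edges of `D` are pairwise disjoint, they occupy exactly `length D` different vertices
-- in each part.
length-avoiding : ∀ {k} (n : Vec ℕ k) {D} → AllPairs Disjoint D →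
  length (avoiding n D) ≡ ∏ (_∸ length D) n
length-avoiding []      D# = refl
length-avoiding (x ∷ n) {D} D# = trans
  (length-cartesianProductWith VecAll._∷_ (unused D) (avoiding n (map VecAll.tail D)))
  (cong₂ _*_ |unused| |avoiding|)
  where
  heads = map VecAll.head D
  heads! : Unique heads
  heads! = AllPairs.map⁺ (AllPairs.map
    (λ { {_ VecAll.∷ _} {_ VecAll.∷ _} e#e′ → e#e′ zero }) D#)
  |unused|+ : length (unused D) + length D ≡ x
  |unused|+ = trans (cong (length (unused D) +_) (sym (length-map VecAll.head D)))
    (trans (length-filter-∉ Fin._≟_ (allFin⁺ x) heads! (λ {v} _ → ∈-allFin v)) (length-tabulate id))
  |unused| : length (unused D) ≡ x ∸ length D
  |unused| = trans (sym (m+n∸n≡m (length (unused D)) (length D))) (cong (_∸ length D) |unused|+)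
  |avoiding| : length (avoiding n (map VecAll.tail D)) ≡ ∏ (_∸ length D) n
  |avoiding| = trans
    (length-avoiding n (AllPairs.map⁺ (AllPairs.map (λ {e} {e′} → tail-disjoint {e = e} {e′}) D#)))
    (cong (λ l → ∏ (_∸ l) n) (length-map VecAll.tail D))

-- Matchings

matched-disjoint : ∀ {k} {n : Vec ℕ k} {es : List (Edge n)} → AllPairs Disjoint es →
  ∀ {d e} → d ∈ es → e ∈ es → d ≢ e → Disjoint d e
matched-disjoint (x# ∷ es#) (here refl) (here refl) d≢e = contradiction refl d≢e
matched-disjoint (x# ∷ es#) (here refl) (there e∈)  d≢e = All.lookup x# e∈
matched-disjoint (x# ∷ es#) {d} {e} (there d∈) (here refl) d≢e =
  disjoint-sym {e = e} {d} (All.lookup x# d∈)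
matched-disjoint (x# ∷ es#) (there d∈)  (there e∈)  d≢e = matched-disjoint es# d∈ e∈ d≢e

submatching-disjoint : ∀ {k} {n : Vec ℕ k} {D es : List (Edge n)} → AllPairs Disjoint es →
  Unique D → D ⊆ es → AllPairs Disjoint D
submatching-disjoint es# []        D⊆es = []
submatching-disjoint es# (d≢ ∷ D!) D⊆es =
  All.tabulate (λ e∈ → matched-disjoint es# (D⊆es (here refl)) (D⊆es (there e∈)) (All.lookup d≢ e∈))
  ∷ submatching-disjoint es# D! (D⊆es ∘ there)

module _ {k : ℕ} {n : Vec ℕ (suc k)} {r : ℕ} where

  open Setoid (𝒦 r n) using (_≈_) renaming (refl to ≈-refl)
  open SetoidMembership (𝒦 r n) using () renaming (_∈_ to _∈ᴷ_)
  open SetoidUnique (𝒦 r n) using () renaming (Unique to Uniqueᴷ)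

  edges-unique : (M : Matching n r) → Unique (edges M)
  edges-unique M = AllPairs.map (λ {e} {e′} → disjoint⇒≢ {e = e} {e′}) (disjoint M)

  ≈⇒⊆ : ∀ {M M′ : Matching n r} → M ≈ M′ → edges M ⊆ edges M′
  ≈⇒⊆ M≈M′ = Equivalence.to M≈M′

  -- Both matchings have exactly `r` edges, so inclusion in one direction suffices. It also makes
  -- equality of matchings decidable.
  ⊆⇒≈ : ∀ {M M′ : Matching n r} → edges M ⊆ edges M′ → M ≈ M′
  ⊆⇒≈ {M} {M′} M⊆M′ = mk⇔ M⊆M′ (Unique-⊆-antisym _≟ᴱ_ (edges-unique M) M⊆M′
    (≤-reflexive (trans (size M′) (sym (size M)))))

  _≈?_ : (M M′ : Matching n r) → Dec (M ≈ M′)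
  M ≈? M′ = map′ (⊆⇒≈ {M} {M′}) (≈⇒⊆ {M} {M′}) (_⊆?_ _≟ᴱ_ (edges M) (edges M′))

  ∈⇒∈ᴷ : ∀ {M Ms} → M ∈ Ms → M ∈ᴷ Ms
  ∈⇒∈ᴷ = Any.map λ { {M} refl → ≈-refl {M} }

  through : Edge n → List (Matching n r) → List (Matching n r)
  through e = filter (λ M → e ∈ᴱ? edges M)

  through-unique : ∀ e {Ms} → Uniqueᴷ Ms → Uniqueᴷ (through e Ms)
  through-unique e = SetoidUniqueP.filter⁺ (𝒦 r n) (λ M → e ∈ᴱ? edges M)

  ∈-through : ∀ e {Ms M} → M ∈ through e Ms → M ∈ Ms × e ∈ edges M
  ∈-through e {Ms} = ∈-filter⁻ (λ M → e ∈ᴱ? edges M) {xs = Ms}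

  -- The edges of M disjoint from D are exactly those outside D.
  length-extending : ∀ {D} M → AllPairs Disjoint D → D ⊆ edges M →
    length (filter (_∈ᴱ? edges M) (avoiding n D)) + length D ≡ r
  length-extending {D} M D# D⊆M = trans
    (cong (_+ length D) (≤-antisym
      (Unique-⊆⇒length-≤ (filter⁺ _ (avoiding-unique n D)) ⊆outside)
      (Unique-⊆⇒length-≤ (filter⁺ _ (edges-unique M)) outside⊆)))
    (trans (length-filter-∉ _≟ᴱ_ (edges-unique M) D! D⊆M) (size M))
    where
    D! : Unique D
    D! = AllPairs.map (λ {e} {e′} → disjoint⇒≢ {e = e} {e′}) D#
    ⊆outside : filter (_∈ᴱ? edges M) (avoiding n D) ⊆ filter (λ e → ¬? (e ∈ᴱ? D)) (edges M)
    ⊆outside {e} e∈ with e∈avoiding , e∈M ← ∈-filter⁻ (_∈ᴱ? edges M) {xs = avoiding n D} e∈ =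
      ∈-filter⁺ _ e∈M (λ e∈D → All.lookup (∈-avoiding⁻ n D e∈avoiding) e∈D zero refl)
    outside⊆ : filter (λ e → ¬? (e ∈ᴱ? D)) (edges M) ⊆ filter (_∈ᴱ? edges M) (avoiding n D)
    outside⊆ e∈ with e∈M , e∉D ← ∈-filter⁻ (λ e → ¬? (e ∈ᴱ? D)) {xs = edges M} e∈ =
      ∈-filter⁺ _ (∈-avoiding⁺ n D (All.tabulate λ d∈D →
        matched-disjoint (disjoint M) e∈M (D⊆M d∈D) λ { refl → e∉D d∈D })) e∈M

  star-count : ∀ m D → AllPairs Disjoint D → length D + m ≡ r →
    ∀ Ms → Uniqueᴷ Ms → All (λ M → D ⊆ edges M) Ms →
    m ! * length Ms ≤ ∏ (λ x → (x ∸ length D) P m) n ×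
    ((∀ M → D ⊆ edges M → M ∈ᴷ Ms) → m ! * length Ms ≡ ∏ (λ x → (x ∸ length D) P m) n)
  star-count zero D D# |D|≡r Ms Ms! D⊆ =
    subst (λ p → 1 * length Ms ≤ p × ((∀ M → D ⊆ edges M → M ∈ᴷ Ms) → 1 * length Ms ≡ p))
      (sym (∏-1 n))
      ( |Ms|≤1
      , λ full → ≤-antisym |Ms|≤1
          (≤-trans (SetoidMembershipP.∈-length (𝒦 r n) {M-D} (full M-D id)) (≤-reflexive (sym (*-identityˡ _)))))
    where
    |D| : length D ≡ r
    |D| = trans (sym (+-identityʳ _)) |D|≡r
    M-D : Matching n r
    M-D = record { edges = D ; size = |D| ; disjoint = D# }
    at-most-one : ∀ Ms → Uniqueᴷ Ms → All (λ M → D ⊆ edges M) Ms → length Ms ≤ 1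
    at-most-one []          _                 _                = z≤n
    at-most-one (M ∷ [])    _                 _                = ≤-refl
    at-most-one (M ∷ M′ ∷ _) ((M≉M′ ∷ _) ∷ _) (D⊆M ∷ D⊆M′ ∷ _) =
      -- Here `D` already has `r` edges, so both matchings equal `M-D` and hence each other.
      ⊥-elim (M≉M′ (⊆⇒≈ {M} {M′} (⊆-trans (Equivalence.from (⊆⇒≈ {M-D} {M} D⊆M)) D⊆M′)))
    |Ms|≤1 : 1 * length Ms ≤ 1
    |Ms|≤1 = ≤-trans (≤-reflexive (*-identityˡ _)) (at-most-one Ms Ms! D⊆)
  star-count (suc m) D D# |D|+m≡r Ms Ms! D⊆ =
    ( begin
        suc m ! * length Ms             ≡⟨ double-count ⟩
        m ! * sum (map |through| E)     ≤⟨ sum-map-≤ |through| (m !) (All.tabulate (proj₁ ∘ bound)) ⟩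
        length E * Q                    ≡⟨ product-E ⟩
        ∏ (λ x → (x ∸ length D) P suc m) n ∎)
    , λ full → begin-equality
        suc m ! * length Ms             ≡⟨ double-count ⟩
        m ! * sum (map |through| E)
          ≡⟨ sum-map-≡ |through| (m !) (All.tabulate λ {e} e∈ → proj₂ (bound e∈) (full-through full)) ⟩
        length E * Q                    ≡⟨ product-E ⟩
        ∏ (λ x → (x ∸ length D) P suc m) n ∎
    where
    open ≤-Reasoning
    E = avoiding n D
    Q = ∏ (λ x → (x ∸ suc (length D)) P m) n
    |through| : Edge n → ℕ
    |through| e = length (through e Ms)
    -- The multiplicity in the double count: `M` has `suc m` edges outside `D`. The factor 1 fits
    -- the shape of `sum-map-≡`.
    extending : ∀ {M} → M ∈ Ms → 1 * length (filter (_∈ᴱ? edges M) E) ≡ suc m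
    extending {M} M∈Ms = trans (*-identityˡ _) (+-cancelʳ-≡ (length D) _ _
      (trans (length-extending M D# (All.lookup D⊆ M∈Ms)) (trans (sym |D|+m≡r) (+-comm (length D) (suc m)))))
    double-count : suc m ! * length Ms ≡ m ! * sum (map |through| E)
    double-count = begin-equality
      suc m * m ! * length Ms    ≡⟨ rearrange (suc m) (m !) (length Ms) ⟩
      m ! * (length Ms * suc m)
        ≡⟨ cong (m ! *_) (trans (sym (sum-map-≡ _ 1 (All.tabulate extending))) (*-identityˡ _)) ⟩
      m ! * sum (map (λ M → length (filter (_∈ᴱ? edges M) E)) Ms)
        ≡⟨ cong (m ! *_) (double-counting (λ e M → e ∈ᴱ? edges M) E Ms) ⟨
      m ! * sum (map |through| E) ∎
      where
      rearrange : ∀ a b c → a * b * c ≡ b * (c * a)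
      rearrange = solve-∀
    product-E : length E * Q ≡ ∏ (λ x → (x ∸ length D) P suc m) n
    product-E = trans (cong (_* Q) (length-avoiding n D#)) (sym (∏-P-suc (length D) m n))
    bound : ∀ {e} → e ∈ E → m ! * |through| e ≤ Q ×
      ((∀ M → e ∷ D ⊆ edges M → M ∈ᴷ through e Ms) → m ! * |through| e ≡ Q)
    bound {e} e∈E = star-count m (e ∷ D) (∈-avoiding⁻ n D e∈E ∷ D#)
      (trans (sym (+-suc (length D) m)) |D|+m≡r) (through e Ms) (through-unique e Ms!)
      (All.tabulate λ M∈ → let M∈Ms , e∈M = ∈-through e M∈ in ∈-∷⁺ʳ e∈M (All.lookup D⊆ M∈Ms))
    full-through : (∀ M → D ⊆ edges M → M ∈ᴷ Ms) →
      ∀ {e} M → e ∷ D ⊆ edges M → M ∈ᴷ through e Ms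
    full-through full {e} M eD⊆M = SetoidMembershipP.∈-filter⁺ (𝒦 r n) (λ M → e ∈ᴱ? edges M)
      (λ {M} {M′} M≈M′ → ≈⇒⊆ {M} {M′} M≈M′) {M} (full M (eD⊆M ∘ there)) (eD⊆M (here refl))

  -- Branching in a t-intersecting family

  module _ (t : ℕ) (F : Family n r) where

    InStar : Set
    InStar = ∃[ C ] All (λ M → edges {n = n} {r = t} C ⊆ edges M) (members F)

    -- Quantifying over all repetition-free lists of members through `D` lets the bound for `e ∷ D`
    -- apply directly to `through e Ms`.
    Bounded : ℕ → ℕ → List (Edge n) → Set
    Bounded a b D = ∀ Ms → Uniqueᴷ Ms → All (_∈ members F) Ms →
      All (λ M → D ⊆ edges M) Ms → a * length Ms ≤ b

    -- If all the shared edges, at least `t` in number, lay in `D`, which has at most `t`, they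
    -- would make up the whole of `D`. Then `D` would have `t` edges and lie in `M′`, which is the
    -- excluded case.
    new-edge : Intersecting t F → ∀ {D} → Unique D → length D ≤ t →
      ∀ {M′} → M′ ∈ members F → ¬ (t ≤ length D × D ⊆ edges M′) →
      ∀ {M} → M ∈ members F → D ⊆ edges M → ∃[ e ] e ∈ edges M × e ∈ edges M′ × e ∉ D
    new-edge F-int {D} D! |D|≤t {M′} M′∈F D⊈M′ {M} M∈F D⊆M
      with any? (λ e → ¬? (e ∈ᴱ? D)) (filter (_∈ᴱ? edges M′) (edges M))
    ... | yes ∃e with e , e∈ , e∉D ← find ∃e
                 with e∈M , e∈M′ ← ∈-filter⁻ (_∈ᴱ? edges M′) {xs = edges M} e∈ = e , e∈M , e∈M′ , e∉D
    ... | no  ∄e = ⊥-elim (D⊈M′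
        (t≤|D| , ⊆-trans D⊆shared (proj₂ ∘ ∈-filter⁻ (_∈ᴱ? edges M′) {xs = edges M})))
      where
      shared = filter (_∈ᴱ? edges M′) (edges M)
      shared! : Unique shared
      shared! = filter⁺ _ (edges-unique M)
      shared⊆D : shared ⊆ D
      shared⊆D {e} e∈ = decidable-stable (e ∈ᴱ? D) λ e∉D → ∄e (lose e∈ e∉D)
      t≤|shared| : t ≤ length shared
      t≤|shared| = F-int M M′ (∈⇒∈ᴷ M∈F) (∈⇒∈ᴷ M′∈F)
      t≤|D| : t ≤ length D
      t≤|D| = ≤-trans t≤|shared| (Unique-⊆⇒length-≤ shared! shared⊆D)
      D⊆shared : D ⊆ shared
      D⊆shared = Unique-⊆-antisym _≟ᴱ_ shared! shared⊆D (≤-trans |D|≤t t≤|shared|)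

    -- A union bound: by `new-edge`, the families `through e Ms` cover `Ms` as `e` runs over the at
    -- most `r` edges of `M′` outside `D`.
    bounded-∷ : Intersecting t F → ∀ {a c D} → Unique D → length D ≤ t →
      ∀ {M′} → M′ ∈ members F → ¬ (t ≤ length D × D ⊆ edges M′) →
      All (λ e → Bounded a c (e ∷ D)) (filter (λ e → ¬? (e ∈ᴱ? D)) (edges M′)) →
      Bounded a (r * c) D
    bounded-∷ F-int {a} {c} {D} D! |D|≤t {M′} M′∈F D⊈M′ bounds Ms Ms! Ms⊆F D⊆ = begin
      a * length Ms                     ≡⟨ cong (a *_) (*-identityʳ _) ⟨
      a * (length Ms * 1)               ≤⟨ *-monoʳ-≤ a (sum-map-≥ hits 1 (All.tabulate hit)) ⟩
      a * (1 * sum (map hits Ms))       ≡⟨ cong (a *_) (*-identityˡ _) ⟩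
      a * sum (map hits Ms)             ≡⟨ cong (a *_) (double-counting (λ e M → e ∈ᴱ? edges M) L Ms) ⟨
      a * sum (map (λ e → length (through e Ms)) L) ≤⟨ sum-map-≤ _ a (All.tabulate bound) ⟩
      length L * c                      ≤⟨ *-monoˡ-≤ c (length-filter _ (edges M′)) ⟩
      length (edges M′) * c             ≡⟨ cong (_* c) (size M′) ⟩
      r * c                             ∎
      where
      open ≤-Reasoning
      L = filter (λ e → ¬? (e ∈ᴱ? D)) (edges M′)
      hits : Matching n r → ℕ
      hits M = length (filter (_∈ᴱ? edges M) L)
      hit : ∀ {M} → M ∈ Ms → 1 ≤ 1 * hits M
      hit {M} M∈Ms
        with e , e∈M , e∈M′ , e∉D ←
          new-edge F-int D! |D|≤t M′∈F D⊈M′ (All.lookup Ms⊆F M∈Ms) (All.lookup D⊆ M∈Ms) =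
        ≤-trans (filter-some (_∈ᴱ? edges M) (lose (∈-filter⁺ _ e∈M′ e∉D) e∈M))
          (≤-reflexive (sym (*-identityˡ _)))
      bound : ∀ {e} → e ∈ L → a * length (through e Ms) ≤ c
      bound {e} e∈L = All.lookup bounds e∈L (through e Ms) (through-unique e Ms!)
        (All.tabulate (All.lookup Ms⊆F ∘ proj₁ ∘ ∈-through e))
        (All.tabulate λ M∈ → let M∈Ms , e∈M = ∈-through e M∈ in ∈-∷⁺ʳ e∈M (All.lookup D⊆ M∈Ms))

    -- Induction on `j`, the number of edges still to be added to `D`; each level costs a factor
    -- `r`. If no suitable `M′` exists for a nonempty `F`, then `D` has exactly `t` edges and lies
    -- in every member, so it is the centre of a star.
    branch : Intersecting t F → ∀ {m} → suc t + m ≡ r → ∀ j D → Unique D → length D + j ≡ suc t →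
      InStar ⊎ Bounded (m !) (r ^ j * ∏ (λ x → (x ∸ suc t) P m) n) D
    -- `D` is only known to be free of repetitions. It is a matching as soon as some member contains
    -- it, so the empty list is treated separately.
    branch F-int {m} 1+t+m≡r zero D D! |D|+0≡1+t = inj₂ λ where
        []         _   _ _            → ≤-trans (≤-reflexive (*-zeroʳ (m !))) z≤n
        Ms@(M ∷ _) Ms! _ D⊆@(D⊆M ∷ _) → subst (m ! * length Ms ≤_) Q≡
          (proj₁ (star-count m D (submatching-disjoint (disjoint M) D! D⊆M)
            (trans (cong (_+ m) |D|≡1+t) 1+t+m≡r) Ms Ms! D⊆))
      where
      |D|≡1+t : length D ≡ suc t
      |D|≡1+t = trans (sym (+-identityʳ _)) |D|+0≡1+t
      Q≡ : ∏ (λ x → (x ∸ length D) P m) n ≡ 1 * ∏ (λ x → (x ∸ suc t) P m) n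
      Q≡ = trans (cong (λ l → ∏ (λ x → (x ∸ l) P m) n) |D|≡1+t) (sym (*-identityˡ _))
    branch F-int {m} 1+t+m≡r (suc j) D D! |D|+1+j≡1+t
      with |D|≤t ← ≤-trans (m≤m+n (length D) j)
        (≤-reflexive (suc-injective (trans (sym (+-suc (length D) j)) |D|+1+j≡1+t)))
      with any? (λ M → ¬? ((t ≤? length D) ×-dec (_⊆?_ _≟ᴱ_ D (edges M)))) (members F)
    ... | yes ∃M′ with M′ , M′∈F , D⊈M′ ← find ∃M′ =
      Sum.map₂ (subst (λ b → Bounded (m !) b D) (sym (*-assoc r (r ^ j) _))
          ∘ bounded-∷ F-int {m !} D! |D|≤t M′∈F D⊈M′)
        (All-⊎ (All.tabulate λ {e} e∈ → branch F-int 1+t+m≡r j (e ∷ D)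
          (Unique-∷ (proj₂ (∈-filter⁻ (λ e → ¬? (e ∈ᴱ? D)) {xs = edges M′} e∈)) D!)
          (trans (sym (+-suc (length D) j)) |D|+1+j≡1+t)))
    ... | no ∄M′ = in-star (members F) refl
      where
      D-common : ∀ {M} → M ∈ members F → t ≤ length D × D ⊆ edges M
      D-common {M} M∈F = decidable-stable ((t ≤? length D) ×-dec (_⊆?_ _≟ᴱ_ D (edges M)))
        λ D⊈M → ∄M′ (lose M∈F D⊈M)
      -- A member is needed to conclude that `D` is a matching with at least `t` edges. An empty `F`
      -- satisfies the bound trivially.
      in-star : ∀ Ms → Ms ≡ members F → InStar ⊎ Bounded (m !) (r ^ suc j * ∏ (λ x → (x ∸ suc t) P m) n) D
      in-star []       []≡F = inj₂ λ where
        []      _ _         _ → ≤-trans (≤-reflexive (*-zeroʳ (m !))) z≤n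
        (_ ∷ _) _ (M∈F ∷ _) _ → case subst (_ ∈_) (sym []≡F) M∈F of λ ()
      in-star (M ∷ Ms) Ms≡F = inj₁ (C , All.tabulate (proj₂ ∘ D-common))
        where
        common : t ≤ length D × D ⊆ edges M
        common = D-common (subst (M ∈_) Ms≡F (here refl))
        C : Matching n t
        C = record
          { edges    = D
          ; size     = ≤-antisym |D|≤t (proj₁ common)
          ; disjoint = submatching-disjoint (disjoint M) D! (proj₂ common)
          }

    -- Sizes of stars and their subfamilies

    -- This is `star-count` divided by the factorial. The left side is an exact multiple of it, so
    -- monotonicity of rounded-down division gives the bound.
    star-bound : t ≤ r → (C : Matching n t) → ∀ Ms → Uniqueᴷ Ms → All (λ M → edges C ⊆ edges M) Ms →
      length Ms ≤ starSize n r t ×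
      ((∀ M → edges C ⊆ edges M → M ∈ᴷ Ms) → length Ms ≡ starSize n r t)
    star-bound t≤r C Ms Ms! C⊆
      with count≤ , count≡ ← star-count (r ∸ t) (edges C) (disjoint C)
        (trans (cong (_+ (r ∸ t)) (size C)) (m+[n∸m]≡n t≤r)) Ms Ms! C⊆
      rewrite size C =
        subst (_≤ starSize n r t) cancel (/-monoˡ-≤ ((r ∸ t) !) count≤)
      , λ full → trans (sym cancel) (cong (λ p → p / (r ∸ t) !) (count≡ full))
      where
      instance _ = (r ∸ t) !≢0
      cancel : ((r ∸ t) ! * length Ms) / (r ∸ t) ! ≡ length Ms
      cancel = trans (cong (λ p → p / (r ∸ t) !) (*-comm ((r ∸ t) !) (length Ms)))
        (m*n/n≡m (length Ms) ((r ∸ t) !))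

    IsStar⇒size : t ≤ r → IsStar t F → ∣ F ∣ ≡ starSize n r t
    IsStar⇒size t≤r (C , M∈F⇔C⊆M) = proj₂
      (star-bound t≤r C (members F) (unique F)
        (All.tabulate λ {M} M∈F → Equivalence.to (M∈F⇔C⊆M M) (∈⇒∈ᴷ M∈F)))
      (λ M → Equivalence.from (M∈F⇔C⊆M M))

    InStar⇒≤ : t ≤ r → InStar → ∣ F ∣ ≤ starSize n r t
    InStar⇒≤ t≤r (C , C⊆) = proj₁ (star-bound t≤r C (members F) (unique F) C⊆)

    -- If a matching through `C` were missing from `F`, adding it would give a subfamily of the star
    -- larger than `starSize`.
    InStar⇒IsStar : t ≤ r → InStar → ∣ F ∣ ≡ starSize n r t → IsStar t F
    InStar⇒IsStar t≤r (C , C⊆) |F|≡ = C , λ M → mk⇔ (C⊆M {M}) (M∈F M)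
      where
      C⊆M : ∀ {M} → M ∈ᴷ members F → edges C ⊆ edges M
      C⊆M M∈F with C⊆M′ , M≈M′ ← All.lookupAny C⊆ M∈F = ⊆-trans C⊆M′ (Equivalence.from M≈M′)
      M∈F : ∀ M → edges C ⊆ edges M → M ∈ᴷ members F
      M∈F M C⊆M = decidable-stable (any? (M ≈?_) (members F)) λ M∉F →
        <-irrefl |F|≡ (proj₁ (star-bound t≤r C (M ∷ members F)
          (¬Any⇒All¬ _ M∉F ∷ unique F) (C⊆M ∷ C⊆)))

-- Comparison with the star and conclusion

-- The case `t = r`: matchings sharing all `r` edges coincide, so any member is itself the centre of
-- a star containing `F`. An empty `F` falls short because `starSize n r r` is 1.
intersecting-in-all : ∀ {k} {n : Vec ℕ (suc k)} {r} (F : Family n r) → Intersecting r F →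
  InStar r F ⊎ ∣ F ∣ < starSize n r r
intersecting-in-all {n = n} {r} record { members = [] } F-int = inj₂
  (subst (λ m → 0 < (∏ (λ x → (x ∸ r) P m) n / m !) {{m !≢0}}) (sym (n∸n≡0 r))
    (subst (λ p → 0 < p / 1) (sym (∏-1 n)) ≤-refl))
intersecting-in-all {r = r} record { members = M ∷ Ms } F-int = inj₁ (M , All.tabulate λ {M′} M′∈F →
  ⊆-trans
    (Unique-⊆-antisym _≟ᴱ_ (filter⁺ _ (edges-unique M)) (filter-⊆ (_∈ᴱ? edges M′) (edges M))
      (subst (_≤ ∣ M ∩ M′ ∣) (sym (size M)) (F-int M M′ (∈⇒∈ᴷ (here refl)) (∈⇒∈ᴷ M′∈F))))
    (proj₂ ∘ ∈-filter⁻ (_∈ᴱ? edges M′) {xs = edges M}))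

-- Passing from `m !` to `suc m !` costs a factor `suc m`, which the first part supplies because it
-- has at least `r` vertices. The second part supplies `r ^ suc t + m !`, and every other part at
-- least 1.
<starSize : ∀ {k} (n : Vec ℕ (2 + k)) {r t m f} → suc t + m ≡ r → VecAll.All (r ≤_) n →
  t + (r ^ suc t + m !) ≤ lookup n (suc zero) →
  m ! * f ≤ r ^ suc t * ∏ (λ x → (x ∸ suc t) P m) n → f < starSize n r t
<starSize n@(x ∷ y ∷ n′) {t = t} {m} {f} refl r≤n@(r≤x VecAll.∷ r≤y VecAll.∷ r≤n′) n₀≤y f≤ =
  subst (_≤ starSize n r t) (m*n/n≡m (suc f) ((r ∸ t) !))
    (/-monoˡ-≤ ((r ∸ t) !) (subst (λ l → suc f * l ! ≤ ∏ (λ x → (x ∸ t) P l) n) (sym r∸t≡1+m) product-bound))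
  where
  r = suc t + m
  instance _ = (r ∸ t) !≢0
  r∸t≡1+m : r ∸ t ≡ suc m
  r∸t≡1+m = trans (cong (_∸ t) (sym (+-suc t m))) (m+n∸m≡n t (suc m))
  1+m≤ : ∀ {z} → r ≤ z → suc m ≤ z ∸ t
  1+m≤ {z} r≤z = subst (_≤ z ∸ t) r∸t≡1+m (∸-monoˡ-≤ t r≤z)
  Q = ∏ (λ x → (x ∸ suc t) P m) n
  c = r ^ suc t + m !
  1≤Q : 1 ≤ Q
  1≤Q = 1≤∏ (λ x → (x ∸ suc t) P m) (VecAll.map
    (λ r≤z → 1≤P (subst (_≤ _) (m+n∸m≡n (suc t) m) (∸-monoˡ-≤ (suc t) r≤z))) r≤n)
  c≤y∸t : c ≤ y ∸ t
  c≤y∸t = subst (_≤ y ∸ t) (m+n∸m≡n t c) (∸-monoˡ-≤ t n₀≤y)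
  [1+m]c≤∏ : suc m * c ≤ ∏ (_∸ t) n
  [1+m]c≤∏ = *-mono-≤ (1+m≤ r≤x) (≤-trans (≤-reflexive (sym (*-identityʳ c)))
    (*-mono-≤ c≤y∸t (1≤∏ (_∸ t) (VecAll.map (λ r≤z → ≤-trans (s≤s z≤n) (1+m≤ r≤z)) r≤n′))))
  product-bound : suc f * suc m ! ≤ ∏ (λ x → (x ∸ t) P suc m) n
  product-bound = begin
    suc f * (suc m * m !)                ≡⟨ rearrange f (suc m) (m !) ⟩
    -- The summand `m ! * 1` comes from counting `suc f` instead of `f`. It is absorbed into
    -- `m ! * Q` because `Q` is positive, and this is what makes the inequality strict.
    suc m * (m ! * f + m ! * 1)          ≤⟨ *-monoʳ-≤ (suc m) (+-mono-≤ f≤ (*-monoʳ-≤ (m !) 1≤Q)) ⟩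
    suc m * (r ^ suc t * Q + m ! * Q)    ≡⟨ cong (suc m *_) (*-distribʳ-+ Q (r ^ suc t) (m !)) ⟨
    suc m * (c * Q)                      ≡⟨ *-assoc (suc m) c Q ⟨
    suc m * c * Q                        ≤⟨ *-monoˡ-≤ Q [1+m]c≤∏ ⟩
    ∏ (_∸ t) n * Q                       ≡⟨ ∏-P-suc t m n ⟨
    ∏ (λ x → (x ∸ t) P suc m) n          ∎
    where
    open ≤-Reasoning
    rearrange : ∀ f a b → suc f * (a * b) ≡ a * (b * f + b * 1)
    rearrange = solve-∀

theorem3p3 : (r t : ℕ) → 1 ≤ t → t ≤ r →
    ∃[ n₀ ] ((k : ℕ) (n : Vec ℕ (2 + k)) →
    Linked _≤_ (r ∷ n) →
    n₀ ≤ lookup n (suc zero) →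
    (F : Family n r) → Intersecting t F →
    (∣ F ∣ ≤ starSize n r t) ×
    (∣ F ∣ ≡ starSize n r t ⇔ IsStar t F))
-- The witness is chosen so that the second part, after removal of `t` vertices, still has the
-- `r ^ suc t + m !` vertices that `<starSize` asks for, with `m = r ∸ suc t`.
theorem3p3 r t 1≤t t≤r = t + (r ^ suc t + (r ∸ suc t) !) , λ k n r≤n n₀≤n₂ F F-int →
  conclude F (dichotomy n r≤n n₀≤n₂ F F-int)
  where
  conclude : ∀ {k} {n : Vec ℕ (suc k)} (F : Family n r) → InStar t F ⊎ ∣ F ∣ < starSize n r t →
    (∣ F ∣ ≤ starSize n r t) × (∣ F ∣ ≡ starSize n r t ⇔ IsStar t F)
  conclude F (inj₁ F⊆star) =
    InStar⇒≤ t F t≤r F⊆star , mk⇔ (InStar⇒IsStar t F t≤r F⊆star) (IsStar⇒size t F t≤r)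
  conclude F (inj₂ |F|<) =
    <⇒≤ |F|< , mk⇔ (λ |F|≡ → contradiction |F|< (<-irrefl |F|≡)) (IsStar⇒size t F t≤r)

  dichotomy : ∀ {k} (n : Vec ℕ (2 + k)) → Linked _≤_ (r ∷ n) →
    t + (r ^ suc t + (r ∸ suc t) !) ≤ lookup n (suc zero) →
    (F : Family n r) → Intersecting t F → InStar t F ⊎ ∣ F ∣ < starSize n r t
  dichotomy n@(_ ∷ _ ∷ _) (r≤x ∷ n↗) n₀≤n₂ F F-int with m≤n⇒m<n∨m≡n t≤r
  -- Branching fixes `suc t` edges, so it requires `t < r`. It starts from the empty `D`, which
  -- every member contains, and the resulting bound is applied to the whole of `F`.
  ... | inj₁ t<r = Sum.map₂
    (λ bounded → <starSize n {t = t} {m = r ∸ suc t} (m+[n∸m]≡n t<r)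
      (Linked⇒All ≤-trans r≤x n↗) n₀≤n₂
      (bounded (members F) (unique F) (All.tabulate id) (All.universal (λ _ ()) (members F))))
    (branch t F F-int (m+[n∸m]≡n t<r) (suc t) [] [] refl)
  ... | inj₂ refl = intersecting-in-all F F-int
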